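{- Let $S=\{x_1,\dots,x_n\}$ be a gcd closed set of $n$ distinct positive integers satisfying condition $\mathcal{G}$, and let $a,b$ be positive integers with $a\mid b$. Then, in the ring $M_n(\mathbb{Z})$, $$\big((x_i,x_j)^a\big)\,\big|\,\big((x_i,x_j)^b\big),\qquad \big((x_i,x_j)^a\big)\,\big|\,\big([x_i,x_j]^a\big),\qquad \big([x_i,x_j]^a\big)\,\big|\,\big([x_i,x_j]^b\big).$$
   Context: $(x,y)$ denotes the greatest common divisor and $[x,y]$ the least common multiple; $((x_i,x_j)^a)$ and $([x_i,x_j]^a)$ denote the $n\times n$ matrices with $(i,j)$-entries $(x_i,x_j)^a$ and $[x_i,x_j]^a$. For $A,B\in M_n(\mathbb{Z})$, $A\mid B$ means there is $C\in M_n(\mathbb{Z})$ with $B=AC$ or $B=CA$. A set $S$ is gcd closed if $(x,y)\in S$ for all $x,y\in S$. For $x\in S$, an element $y\in S$ is a greatest-type divisor of $x$ in $S$ if $y\mid x$, $y<x$, and whenever $d\in S$ with $y\mid d\mid x$ then $d\in\{y,x\}$; $G_S(x)$ is the set of greatest-type divisors of $x$ in $S$. The set $S$ satisfies condition $\mathcal{G}$ if for every $x\in S$ with $|G_S(x)|\ge 2$ and any two distinct $y_1,y_2\in G_S(x)$ one has $[y_1,y_2]=x$ and $(y_1,y_2)\in G_S(y_1)\cap G_S(y_2)$. -}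

module Defs where

open import Data.Integer.Base as ℤ using (ℤ; +_)
import Data.Integer.Properties as ℤ
open import Data.Nat.Base using (ℕ; _<_; _^_)
open import Data.Nat.Divisibility using (_∣_)
open import Data.Nat.GCD using (gcd)
open import Data.Nat.LCM using (lcm)
open import Data.Product.Base using (_×_; ∃-syntax)
open import Data.Sum.Base using (_⊎_)
open import Data.Vec.Functional using (Vector)
open import Level using (0ℓ)
open import Relation.Binary.PropositionalEquality using (_≡_; _≢_)
open import Relation.Unary using (Pred; _∈_; _∩_)
open import Algebra.Properties.Semiring.Sum ℤ.+-*-semiring using (sum-syntax)

infixl 7 _·_
infix  4 _≈ᴹ_ _∣ᴹ_

Matrix : ℕ → Set
Matrix n = Vector (Vector ℤ n) n

_≈ᴹ_ : ∀ {n} → Matrix n → Matrix n → Set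
A ≈ᴹ B = ∀ i j → A i j ≡ B i j

_·_ : ∀ {n} → Matrix n → Matrix n → Matrix n
_·_ {n} A B i j = ∑[ k < n ] (A i k ℤ.* B k j)

_∣ᴹ_ : ∀ {n} → Matrix n → Matrix n → Set
_∣ᴹ_ {n} A B = ∃[ C ] (B ≈ᴹ A · C ⊎ B ≈ᴹ C · A)

gcdMatrix : ∀ {n} → Vector ℕ n → ℕ → Matrix n
gcdMatrix x a i j = + (gcd (x i) (x j) ^ a)

lcmMatrix : ∀ {n} → Vector ℕ n → ℕ → Matrix n
lcmMatrix x a i j = + (lcm (x i) (x j) ^ a)

-- The set {x₁, …, xₙ} enumerated by x.
⟦_⟧ : ∀ {n} → Vector ℕ n → Pred ℕ 0ℓ
⟦ x ⟧ y = ∃[ i ] x i ≡ y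

GCDClosed : Pred ℕ 0ℓ → Set
GCDClosed S = ∀ y z → y ∈ S → z ∈ S → gcd y z ∈ S

-- G S x is the set of greatest-type divisors of x in S (used for x ∈ S).
G : Pred ℕ 0ℓ → ℕ → Pred ℕ 0ℓ
G S x y = y ∈ S × y ∣ x × y < x ×
          (∀ d → d ∈ S → y ∣ d → d ∣ x → d ≡ y ⊎ d ≡ x)

-- The usual proviso |G S x| ≥ 2 is exactly the existence of distinct
-- y₁, y₂ ∈ G S x, so it is already carried by the hypotheses on y₁ and y₂.
ConditionG : Pred ℕ 0ℓ → Set
ConditionG S =
  ∀ x → x ∈ S →
  ∀ y₁ y₂ → y₁ ∈ G S x → y₂ ∈ G S x → y₁ ≢ y₂ →
  lcm y₁ y₂ ≡ x × gcd y₁ y₂ ∈ G S y₁ ∩ G S y₂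

{-# OPTIONS --safe #-}
-- Under condition G, write d ∈ S as g ∏ pᵢ, where the pᵢ = d / eᵢ are the
-- ratios to the greatest-type divisors eᵢ of d. The pᵢ are pairwise coprime and
-- every g ∏_{i ∈ I} pᵢ lies in S. Inclusion–exclusion over this cube turns
-- column d of the gcd matrix into α_a(d) · [d ∣ z], α_a(d) = g^a ∏ (pᵢ^a - 1),
-- and, with weights pᵢ^a, column d of the lcm matrix into
-- β_a(d) · z^a [d ∣ z], β_a(d) = ∏ (1 - pᵢ^a). So the ℤ-spans of the columns
-- are generated by these vectors, and a ∣ b gives α_a(d) ∣ α_b(d) and
-- β_a(d) ∣ β_b(d), which settles the first divisibility.
-- For the other two, Möbius inversion expands z^c [d ∣ z], a ∣ c, in the
-- vectors [e ∣ z], e ∈ S. The part of ∏ (qⱼ^a - 1), over the ratios qⱼ of e,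
-- that may fail to divide the coefficient at e comes from the qⱼ with
-- d ∤ e / qⱼ. By condition G every such qⱼ is also a ratio of d, so that part
-- divides β_a(d).
module Submission where

open import Defs
open import Algebra.Properties.CommutativeSemigroup using (x∙yz≈y∙xz; xy∙z≈xz∙y; interchange)
open import Data.Bool.Base using (if_then_else_)
open import Data.Empty using (⊥-elim)
open import Data.Fin.Base using (Fin; zero; suc)
open import Data.Fin.Properties using (any?; all?)
open import Data.Integer.Base as ℤ using (ℤ; +_; 0ℤ; 1ℤ; -1ℤ)
import Data.Integer.Divisibility.Signed as ℤ
import Data.Integer.Properties as ℤ
open import Algebra.Properties.Semiring.Sum ℤ.+-*-semiring
  using (sum-syntax; ∑-distrib-+; *-distribˡ-sum; sum-cong-≗; sum-replicate-zero)
open import Data.Integer.Tactic.RingSolver using (solve-∀)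
open import Data.List.Base using (List; []; _∷_; _++_; tabulate; filter)
open import Data.List.Membership.Propositional using () renaming (_∈_ to _∈ₗ_)
open import Data.List.Membership.Propositional.Properties
  using (∈-∃++; ∈-++⁺ˡ; ∈-++⁺ʳ; ∈-++⁻; ∈-filter⁺; ∈-tabulate⁺)
open import Data.List.Relation.Binary.Pointwise using (Pointwise; []; _∷_)
open import Data.List.Relation.Unary.All as All using (All; []; _∷_)
open import Data.List.Relation.Unary.All.Properties using (all-filter)
open import Data.List.Relation.Unary.AllPairs using (AllPairs; []; _∷_)
open import Data.List.Relation.Unary.Any using (here; there)
import Data.List.Relation.Unary.Unique.Propositional.Properties as Unique
open import Data.Nat.Base
open import Data.Nat.Coprimality as Coprimality using (Coprime; coprime-divisor; 1-coprimeTo)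
open import Data.Nat.Divisibility
open import Data.Nat.GCD using (gcd; gcd[m,n]∣m; gcd[m,n]∣n; gcd-greatest; gcd[m,n]≢0)
open import Data.Nat.Induction using (Acc; acc; <-wellFounded)
open import Data.Nat.LCM using (lcm; m∣lcm[m,n]; lcm-least; gcd*lcm)
open import Data.Nat.ListAction using (product)
open import Data.Nat.Properties
open import Data.Product.Base using (_×_; _,_; ∃-syntax; proj₁; proj₂; map₂)
open import Data.Sum.Base using (_⊎_; inj₁; inj₂)
open import Data.Vec.Functional using (Vector) renaming (_∷_ to _∷ᵥ_)
open import Function.Base using (_∘_)
open import Function.Definitions using (Injective)
open import Level using (0ℓ)
open import Relation.Binary.PropositionalEquality
  using (_≡_; _≢_; refl; sym; trans; cong; cong₂; subst; subst₂; module ≡-Reasoning)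
open import Relation.Nullary using (¬_; Dec; yes; no; does)
open import Relation.Nullary.Decidable
  using (map′; dec-true; dec-false; _×-dec_; _⊎-dec_; _→-dec_; ¬?)
open import Relation.Unary using (Pred; _∈_)

-- Rearrangement and coprimality of products.

*-swapˡ : ∀ a b c → a * (b * c) ≡ b * (a * c)
*-swapˡ = x∙yz≈y∙xz *-commutativeSemigroup

*-swapʳ : ∀ a b c → a * b * c ≡ a * c * b
*-swapʳ = xy∙z≈xz∙y *-commutativeSemigroup

ℤ*-swapˡ : ∀ a b c → a ℤ.* (b ℤ.* c) ≡ b ℤ.* (a ℤ.* c)
ℤ*-swapˡ = x∙yz≈y∙xz ℤ.*-commutativeSemigroup

coprime-* : ∀ {k m n} → Coprime k m → Coprime k n → Coprime k (m * n)
coprime-* k⊥m k⊥n (d∣k , d∣mn) =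
  k⊥n (d∣k , coprime-divisor (λ (e∣d , e∣m) → k⊥m (∣-trans e∣d d∣k , e∣m)) d∣mn)

coprime-product : ∀ {k ps} → All (Coprime k) ps → Coprime k (product ps)
coprime-product []           = Coprimality.sym (1-coprimeTo _)
coprime-product (k⊥p ∷ k⊥ps) = coprime-* k⊥p (coprime-product k⊥ps)

-- gcd (y q) (y r) = y
coprime-∣ : ∀ {q r k} y → Coprime q r → k ∣ y * q → k ∣ y * r → k ∣ y
coprime-∣ {q} {r} {k} y q⊥r k∣yq k∣yr =
  Coprimality.coprime-factors q⊥r
    (subst (k ∣_) (*-comm y q) k∣yq , subst (k ∣_) (*-comm y r) k∣yr)

-- Cubes of partial products.

-- Cube g ps y r: y is the product of g with some of the ps, and r is the
-- product of the other ones.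
data Cube : ℕ → List ℕ → ℕ → ℕ → Set where
  []   : ∀ {g} → Cube g [] g 1
  take : ∀ {g p ps y r} → Cube (g * p) ps y r → Cube g (p ∷ ps) y r
  skip : ∀ {g p ps y r} → Cube g ps y r → Cube g (p ∷ ps) y (p * r)

cube-factor : ∀ {g ps y r} → Cube g ps y r → y * r ≡ g * product ps
cube-factor [] = refl
cube-factor {g} {p ∷ ps} (take cube) = trans (cube-factor cube) (*-assoc g p (product ps))
cube-factor {g} {p ∷ ps} {y} (skip {r = r} cube) = begin
  y * (p * r)          ≡⟨ *-swapˡ y p r ⟩
  p * (y * r)          ≡⟨ cong (p *_) (cube-factor cube) ⟩
  p * (g * product ps) ≡⟨ *-swapˡ p g (product ps) ⟩
  g * (p * product ps) ∎
  where open ≡-Reasoning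

cube-∣ : ∀ {g ps y r} → Cube g ps y r → y ∣ g * product ps
cube-∣ {y = y} {r} cube = subst (y ∣_) (cube-factor cube) (m∣m*n r)

cube-scale : ∀ {g ps y r} q → Cube g ps y r → Cube (g * q) ps (y * q) r
cube-scale q [] = []
cube-scale q (take {g} {p} {ps} {y} {r} cube) =
  take (subst (λ h → Cube h ps (y * q) r) (*-swapʳ g p q) (cube-scale q cube))
cube-scale q (skip cube) = skip (cube-scale q cube)

cube-coprime : ∀ {g ps y r q} → All (Coprime q) ps → Cube g ps y r → Coprime q r
cube-coprime []           []          = Coprimality.sym (1-coprimeTo _)
cube-coprime (_   ∷ q⊥ps) (take cube) = cube-coprime q⊥ps cube
cube-coprime (q⊥p ∷ q⊥ps) (skip cube) = coprime-* q⊥p (cube-coprime q⊥ps cube)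

-- Weighted alternating sums over a cube.

-- Inclusion–exclusion over a cube; the vertex missing the factors p ∈ I
-- enters with coefficient ∏_{p ∈ I} (- w p).
Δ : (ℕ → ℤ) → (ℕ → ℤ) → ℕ → List ℕ → ℤ
Δ w F g []       = F g
Δ w F g (p ∷ ps) = Δ w F (g * p) ps ℤ.- w p ℤ.* Δ w F g ps

Δ-cong : ∀ w {F H} g ps → (∀ y r → Cube g ps y r → F y ≡ H y) → Δ w F g ps ≡ Δ w H g ps
Δ-cong w g []       eq = eq g 1 []
Δ-cong w g (p ∷ ps) eq = cong₂ (λ s t → s ℤ.- w p ℤ.* t)
  (Δ-cong w (g * p) ps λ y r → eq y r ∘ take)
  (Δ-cong w g ps λ y r → eq y (p * r) ∘ skip)

Δ-zero : ∀ w F g ps → (∀ y r → Cube g ps y r → F y ≡ 0ℤ) → Δ w F g ps ≡ 0ℤ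
Δ-zero w F g []       eq = eq g 1 []
Δ-zero w F g (p ∷ ps) eq = cong₂ ℤ._-_
  (Δ-zero w F (g * p) ps λ y r → eq y r ∘ take)
  (trans (cong (w p ℤ.*_) (Δ-zero w F g ps λ y r → eq y (p * r) ∘ skip)) (ℤ.*-zeroʳ (w p)))

-- The cubes at `g * q` and at `g` correspond vertex by vertex, with equal coefficients, so a factor
-- common to all edges in direction `q` comes out of the sum.
Δ-shift : ∀ w F u q g ps → (∀ y r → Cube g ps y r → F (y * q) ≡ u ℤ.* F y) →
          Δ w F (g * q) ps ≡ u ℤ.* Δ w F g ps
Δ-shift w F u q g []       eq = eq g 1 []
Δ-shift w F u q g (p ∷ ps) eq = begin
  Δ w F (g * q * p) ps ℤ.- w p ℤ.* Δ w F (g * q) ps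
    ≡⟨ cong₂ (λ h t → Δ w F h ps ℤ.- w p ℤ.* t) (*-swapʳ g q p)
         (Δ-shift w F u q g ps λ y r → eq y (p * r) ∘ skip) ⟩
  Δ w F (g * p * q) ps ℤ.- w p ℤ.* (u ℤ.* Δ w F g ps)
    ≡⟨ cong (ℤ._- w p ℤ.* (u ℤ.* Δ w F g ps)) (Δ-shift w F u q (g * p) ps λ y r → eq y r ∘ take) ⟩
  u ℤ.* Δ w F (g * p) ps ℤ.- w p ℤ.* (u ℤ.* Δ w F g ps)
    ≡⟨ factor u (Δ w F (g * p) ps) (w p) (Δ w F g ps) ⟩
  u ℤ.* (Δ w F (g * p) ps ℤ.- w p ℤ.* Δ w F g ps) ∎
  where
  open ≡-Reasoning
  factor : ∀ u s v t → u ℤ.* s ℤ.- v ℤ.* (u ℤ.* t) ≡ u ℤ.* (s ℤ.- v ℤ.* t)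
  factor = solve-∀

Δ-linear : ∀ w F H c g ps →
           Δ w (λ y → F y ℤ.- c ℤ.* H y) g ps ≡ Δ w F g ps ℤ.- c ℤ.* Δ w H g ps
Δ-linear w F H c g []       = refl
Δ-linear w F H c g (p ∷ ps) = trans
  (cong₂ (λ s t → s ℤ.- w p ℤ.* t) (Δ-linear w F H c (g * p) ps) (Δ-linear w F H c g ps))
  (rearrange (Δ w F (g * p) ps) (Δ w F g ps) (Δ w H (g * p) ps) (Δ w H g ps) c (w p))
  where
  rearrange : ∀ s t s′ t′ c v → (s ℤ.- c ℤ.* s′) ℤ.- v ℤ.* (t ℤ.- c ℤ.* t′) ≡
                                (s ℤ.- v ℤ.* t) ℤ.- c ℤ.* (s′ ℤ.- v ℤ.* t′)
  rearrange = solve-∀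

Δ-scale : ∀ w F c g ps → Δ w (λ y → c ℤ.* F y) g ps ≡ c ℤ.* Δ w F g ps
Δ-scale w F c g []       = refl
Δ-scale w F c g (p ∷ ps) = trans
  (cong₂ (λ s t → s ℤ.- w p ℤ.* t) (Δ-scale w F c (g * p) ps) (Δ-scale w F c g ps))
  (rearrange (Δ w F (g * p) ps) (Δ w F g ps) c (w p))
  where
  rearrange : ∀ s t c v → c ℤ.* s ℤ.- v ℤ.* (c ℤ.* t) ≡ c ℤ.* (s ℤ.- v ℤ.* t)
  rearrange = solve-∀

-- The vertices pair off along the edges from `y` to `y * q`; the lower end carries the extra
-- coefficient `- w q`, so each pair cancels. An edge is described by `r`, the product of the
-- missing factors other than `q`, and not by a `Cube`: this form passes to both faces in any other
-- direction.
Δ-vanish : ∀ w F q g ps → q ∈ₗ ps → AllPairs Coprime ps →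
           (∀ y r → y * q * r ≡ g * product ps → Coprime q r → F (y * q) ≡ w q ℤ.* F y) →
           Δ w F g ps ≡ 0ℤ
Δ-vanish w F q g (_ ∷ ps) (here refl) (q⊥ps ∷ _) eq = begin
  Δ w F (g * q) ps ℤ.- w q ℤ.* Δ w F g ps      ≡⟨ cong (ℤ._- w q ℤ.* Δ w F g ps) shift ⟩
  w q ℤ.* Δ w F g ps ℤ.- w q ℤ.* Δ w F g ps    ≡⟨ ℤ.+-inverseʳ (w q ℤ.* Δ w F g ps) ⟩
  0ℤ                                           ∎
  where
  open ≡-Reasoning
  shift = Δ-shift w F (w q) q g ps λ y r cube →
    eq y r (trans (*-swapʳ y q r) (trans (cong (_* q) (cube-factor cube))
             (trans (*-assoc g (product ps) q) (cong (g *_) (*-comm (product ps) q)))))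
           (cube-coprime q⊥ps cube)
Δ-vanish w F q g (p ∷ ps) (there q∈ps) (p⊥ps ∷ ps⊥) eq = cong₂ ℤ._-_
  (Δ-vanish w F q (g * p) ps q∈ps ps⊥ λ y r yqr → eq y r (trans yqr (*-assoc g p _)))
  (trans (cong (w p ℤ.*_) (Δ-vanish w F q g ps q∈ps ps⊥ λ y r yqr q⊥r →
            eq y (p * r) (trans (*-swapˡ (y * q) p r) (trans (cong (p *_) yqr) (*-swapˡ p g (product ps))))
               (coprime-* (Coprimality.sym (All.lookup p⊥ps q∈ps)) q⊥r)))
         (ℤ.*-zeroʳ (w p)))

-- Powers and the factors p^a - 1.

-- The exponent comes first so that `pow a` can serve both as summand and as weight of `Δ`.
pow : ℕ → ℕ → ℤ
pow a y = + (y ^ a)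

pow-* : ∀ a y z → pow a (y * z) ≡ pow a y ℤ.* pow a z
pow-* zero    y z = refl
pow-* (suc a) y z = begin
  + (y * z * (y * z) ^ a)                    ≡⟨ ℤ.pos-* (y * z) ((y * z) ^ a) ⟩
  + (y * z) ℤ.* pow a (y * z)                ≡⟨ cong₂ ℤ._*_ (ℤ.pos-* y z) (pow-* a y z) ⟩
  + y ℤ.* + z ℤ.* (pow a y ℤ.* pow a z)      ≡⟨ interchange ℤ.*-commutativeSemigroup (+ y) (+ z) (pow a y) (pow a z) ⟩
  + y ℤ.* pow a y ℤ.* (+ z ℤ.* pow a z)      ≡⟨ cong₂ ℤ._*_ (ℤ.pos-* y (y ^ a)) (ℤ.pos-* z (z ^ a)) ⟨
  pow (suc a) y ℤ.* pow (suc a) z            ∎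
  where open ≡-Reasoning

pow-+ : ∀ a b y → pow (a + b) y ≡ pow a y ℤ.* pow b y
pow-+ a b y = trans (cong +_ (^-distribˡ-+-* y a b)) (ℤ.pos-* (y ^ a) (y ^ b))

∏ : (ℕ → ℤ) → List ℕ → ℤ
∏ f []       = 1ℤ
∏ f (p ∷ ps) = f p ℤ.* ∏ f ps

∏-++-∷ : ∀ f ps q qs → ∏ f (ps ++ q ∷ qs) ≡ f q ℤ.* ∏ f (ps ++ qs)
∏-++-∷ f []       q qs = refl
∏-++-∷ f (p ∷ ps) q qs = trans (cong (f p ℤ.*_) (∏-++-∷ f ps q qs)) (ℤ*-swapˡ (f p) (f q) _)

*-mono-∣ : ∀ {i j k l} → i ℤ.∣ j → k ℤ.∣ l → i ℤ.* k ℤ.∣ j ℤ.* l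
*-mono-∣ {j = j} {k} i∣j k∣l = ℤ.∣-trans (ℤ.*-monoˡ-∣ k i∣j) (ℤ.*-monoʳ-∣ j k∣l)

∏-mono-∣ : ∀ {f h} → (∀ p → f p ℤ.∣ h p) → ∀ ps → ∏ f ps ℤ.∣ ∏ h ps
∏-mono-∣ f∣h []       = ℤ.∣-refl
∏-mono-∣ f∣h (p ∷ ps) = *-mono-∣ (f∣h p) (∏-mono-∣ f∣h ps)

-- Both signs occur: unit weights on a power produce p^a - 1, weights p^a on a constant produce 1 -
-- p^a.
pow-1 pow-1⁻ : ℕ → ℕ → ℤ
pow-1  a p = pow a p ℤ.- 1ℤ
pow-1⁻ a p = 1ℤ ℤ.- pow a p

-- Induction on the quotient m, by uv - 1 = u(v - 1) + (u - 1) with u = p^a and v = p^(ma).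
pow-1∣pow-1 : ∀ {a c} → a ∣ c → ∀ p → pow-1 a p ℤ.∣ pow-1 c p
pow-1∣pow-1 {a} (divides m refl) p = go m
  where
  telescope : ∀ u v → u ℤ.* v ℤ.- 1ℤ ≡ u ℤ.* (v ℤ.- 1ℤ) ℤ.+ (u ℤ.- 1ℤ)
  telescope = solve-∀
  go : ∀ m → pow-1 a p ℤ.∣ pow-1 (m * a) p
  go zero    = ℤ.divides 0ℤ refl
  go (suc m) = subst (pow-1 a p ℤ.∣_)
    (sym (trans (cong (ℤ._- 1ℤ) (pow-+ a (m * a) p)) (telescope (pow a p) (pow (m * a) p))))
    (ℤ.∣m∣n⇒∣m+n (ℤ.∣n⇒∣m*n (pow a p) (go m)) ℤ.∣-refl)

pow-1⁻∣pow-1 : ∀ a p → pow-1⁻ a p ℤ.∣ pow-1 a p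
pow-1⁻∣pow-1 a p = ℤ.divides -1ℤ (neg (pow a p))
  where
  neg : ∀ u → u ℤ.- 1ℤ ≡ -1ℤ ℤ.* (1ℤ ℤ.- u)
  neg = solve-∀

pow-1∣pow-1⁻ : ∀ a p → pow-1 a p ℤ.∣ pow-1⁻ a p
pow-1∣pow-1⁻ a p = ℤ.divides -1ℤ (neg (pow a p))
  where
  neg : ∀ u → 1ℤ ℤ.- u ≡ -1ℤ ℤ.* (u ℤ.- 1ℤ)
  neg = solve-∀

-- Closed forms: the origin of α and β.

unit : ℕ → ℤ
unit _ = 1ℤ

-- By multiplicativity, direction p contributes p^a from the vertices with p, minus 1 from those
-- without. The result is α_a.
Δ-pow : ∀ a g ps → Δ unit (pow a) g ps ≡ pow a g ℤ.* ∏ (pow-1 a) ps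
Δ-pow a g []       = sym (ℤ.*-identityʳ (pow a g))
Δ-pow a g (p ∷ ps) = begin
  Δ unit (pow a) (g * p) ps ℤ.- 1ℤ ℤ.* Δ unit (pow a) g ps
    ≡⟨ cong₂ (λ s t → s ℤ.- 1ℤ ℤ.* t) (Δ-pow a (g * p) ps) (Δ-pow a g ps) ⟩
  pow a (g * p) ℤ.* ∏ (pow-1 a) ps ℤ.- 1ℤ ℤ.* (pow a g ℤ.* ∏ (pow-1 a) ps)
    ≡⟨ cong (λ s → s ℤ.* ∏ (pow-1 a) ps ℤ.- 1ℤ ℤ.* (pow a g ℤ.* ∏ (pow-1 a) ps)) (pow-* a g p) ⟩
  pow a g ℤ.* pow a p ℤ.* ∏ (pow-1 a) ps ℤ.- 1ℤ ℤ.* (pow a g ℤ.* ∏ (pow-1 a) ps)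
    ≡⟨ factor (pow a g) (pow a p) (∏ (pow-1 a) ps) ⟩
  pow a g ℤ.* (pow-1 a p ℤ.* ∏ (pow-1 a) ps) ∎
  where
  open ≡-Reasoning
  factor : ∀ s t u → s ℤ.* t ℤ.* u ℤ.- 1ℤ ℤ.* (s ℤ.* u) ≡ s ℤ.* ((t ℤ.- 1ℤ) ℤ.* u)
  factor = solve-∀

-- With weights p^a the product is β_a.
Δ-const : ∀ w c g ps → Δ w (λ _ → c) g ps ≡ c ℤ.* ∏ (λ p → 1ℤ ℤ.- w p) ps
Δ-const w c g []       = sym (ℤ.*-identityʳ c)
Δ-const w c g (p ∷ ps) = trans
  (cong₂ (λ s t → s ℤ.- w p ℤ.* t) (Δ-const w c (g * p) ps) (Δ-const w c g ps))
  (factor c (w p) (∏ (λ p → 1ℤ ℤ.- w p) ps))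
  where
  factor : ∀ c v u → c ℤ.* u ℤ.- v ℤ.* (c ℤ.* u) ≡ c ℤ.* ((1ℤ ℤ.- v) ℤ.* u)
  factor = solve-∀

-- Divisibility indicators and their Möbius coefficients.

[_∣_] : ℕ → ℕ → ℤ
[ d ∣ z ] = if does (d ∣? z) then 1ℤ else 0ℤ

∣⇒[∣]≡1 : ∀ {d z} → d ∣ z → [ d ∣ z ] ≡ 1ℤ
∣⇒[∣]≡1 {d} {z} d∣z = cong (if_then 1ℤ else 0ℤ) (dec-true (d ∣? z) d∣z)

∤⇒[∣]≡0 : ∀ {d z} → ¬ d ∣ z → [ d ∣ z ] ≡ 0ℤ
∤⇒[∣]≡0 {d} {z} d∤z = cong (if_then 1ℤ else 0ℤ) (dec-false (d ∣? z) d∤z)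

[∣]-cong : ∀ {d y z} → (d ∣ y → d ∣ z) → (d ∣ z → d ∣ y) → [ d ∣ y ] ≡ [ d ∣ z ]
[∣]-cong {d} {y} {z} to from with d ∣? z
... | yes d∣z = ∣⇒[∣]≡1 (from d∣z)
... | no  d∤z = ∤⇒[∣]≡0 (d∤z ∘ to)

multiplesPow : ℕ → ℕ → ℕ → ℤ
multiplesPow c x z = pow c z ℤ.* [ x ∣ z ]

-- A factor q of qs with x ∣ g ∏ qs / q contributes q ^ c - 1 to Δ; any other
-- one contributes only q ^ c, and its q ^ a - 1 is found among the ps.
∏∣∏*Δ-multiplesPow :
  ∀ {a c x} → a ∣ c → ∀ g qs ps → AllPairs Coprime qs → All (1 <_) qs →
  (∀ q e → q ∈ₗ qs → e * q ≡ g * product qs → ¬ x ∣ e → q ∈ₗ ps) →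
  pow c g ℤ.* ∏ (pow-1 a) qs ℤ.∣ ∏ (pow-1 a) ps ℤ.* Δ unit (multiplesPow c x) g qs
∏∣∏*Δ-multiplesPow {a} {c} {x} a∣c g [] ps [] [] _ =
  ℤ.∣n⇒∣m*n (∏ (pow-1 a) ps) (*-mono-∣ (ℤ.∣-refl {pow c g}) (ℤ.divides [ x ∣ g ] (sym (ℤ.*-identityʳ _))))
∏∣∏*Δ-multiplesPow {a} {c} {x} a∣c g (q ∷ qs) ps (q⊥qs ∷ qs⊥) (1<q ∷ 1<qs) missing
  with x ∣? g * product qs
-- Here `x` divides `y * q` exactly when it divides `y`, so the face with `q` is q^c times the face
-- without it, and q^c - 1 splits off.
... | yes x∣gQ = subst₂ ℤ._∣_ (ℤ*-swapˡ (pow-1 a q) (pow c g) _)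
    (trans (rearrange (pow c q) (∏ (pow-1 a) ps) D) (cong (λ s → ∏ (pow-1 a) ps ℤ.* (s ℤ.- 1ℤ ℤ.* D)) (sym shift)))
    (*-mono-∣ (pow-1∣pow-1 a∣c q)
      (∏∣∏*Δ-multiplesPow a∣c g qs ps qs⊥ 1<qs missing′))
  where
  D = Δ unit (multiplesPow c x) g qs
  shift : Δ unit (multiplesPow c x) (g * q) qs ≡ pow c q ℤ.* D
  shift = Δ-shift unit (multiplesPow c x) (pow c q) q g qs λ y r cube → trans
    (cong₂ ℤ._*_ (pow-* c y q)
      ([∣]-cong (λ x∣yq → coprime-∣ y (cube-coprime q⊥qs cube) x∣yq
                            (subst (x ∣_) (sym (cube-factor cube)) x∣gQ))
                (∣m⇒∣m*n q)))
    (rotate (pow c y) (pow c q) [ x ∣ y ])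
    where
    rotate : ∀ s t u → s ℤ.* t ℤ.* u ≡ t ℤ.* (s ℤ.* u)
    rotate = solve-∀
  -- Since `q` and `p` are coprime and `x` divides `e * p`, having `x` divide `e * q` would force it
  -- to divide `e`.
  missing′ : ∀ p e → p ∈ₗ qs → e * p ≡ g * product qs → ¬ x ∣ e → p ∈ₗ ps
  missing′ p e p∈qs ep≡gQ x∤e = missing p (e * q) (there p∈qs)
    (trans (*-swapʳ e q p) (trans (cong (_* q) ep≡gQ) (trans (*-assoc g _ q) (cong (g *_) (*-comm _ q)))))
    λ x∣eq → x∤e (coprime-∣ e (All.lookup q⊥qs p∈qs) x∣eq (subst (x ∣_) (sym ep≡gQ) x∣gQ))
  rearrange : ∀ s t u → (s ℤ.- 1ℤ) ℤ.* (t ℤ.* u) ≡ t ℤ.* (s ℤ.* u ℤ.- 1ℤ ℤ.* u)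
  rearrange = solve-∀
-- No vertex without `q` is a multiple of `x`, so that face contributes 0. One occurrence of `q` in
-- `ps` is spent to supply q^a - 1.
... | no x∤gQ with ∈-∃++ (missing q (g * product qs) (here refl) gQq≡ x∤gQ)
  where
  gQq≡ = trans (*-assoc g _ q) (cong (g *_) (*-comm _ q))
... | ps₁ , ps₂ , refl = subst₂ ℤ._∣_ (ℤ*-swapˡ (pow-1 a q) (pow c g) _)
    (trans (sym (ℤ.*-assoc (pow-1 a q) _ D))
      (cong₂ ℤ._*_ (sym (∏-++-∷ (pow-1 a) ps₁ q ps₂))
        (trans (sym (ℤ.+-identityʳ D)) (cong (λ s → D ℤ.- 1ℤ ℤ.* s) (sym zero′)))))
    (*-mono-∣ (ℤ.∣-refl {pow-1 a q}) (ℤ.∣-trans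
      (ℤ.*-monoˡ-∣ (∏ (pow-1 a) qs) (ℤ.divides (pow c q) (trans (pow-* c g q) (ℤ.*-comm (pow c g) _))))
      (∏∣∏*Δ-multiplesPow a∣c (g * q) qs (ps₁ ++ ps₂) qs⊥ 1<qs missing′)))
  where
  D = Δ unit (multiplesPow c x) (g * q) qs
  zero′ : Δ unit (multiplesPow c x) g qs ≡ 0ℤ
  zero′ = Δ-zero unit _ g qs λ y r cube → trans
    (cong (pow c y ℤ.*_) (∤⇒[∣]≡0 (λ x∣y → x∤gQ (∣-trans x∣y (cube-∣ cube)))))
    (ℤ.*-zeroʳ (pow c y))
  -- Spending `q` takes nothing from the later factors: one equal to `q` would be coprime to itself,
  -- hence 1.
  missing′ : ∀ p e → p ∈ₗ qs → e * p ≡ g * q * product qs → ¬ x ∣ e → p ∈ₗ ps₁ ++ ps₂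
  missing′ p e p∈qs ep≡gqQ x∤e with ∈-++⁻ ps₁ (missing p e (there p∈qs) (trans ep≡gqQ (*-assoc g q _)) x∤e)
  ... | inj₁ p∈ps₁         = ∈-++⁺ˡ p∈ps₁
  ... | inj₂ (there p∈ps₂) = ∈-++⁺ʳ ps₁ p∈ps₂
  ... | inj₂ (here refl)   = ⊥-elim (<-irrefl (sym (All.lookup q⊥qs p∈qs (∣-refl , ∣-refl))) 1<q)

-- Integer spans of matrix columns.

record Span {n} (A : Matrix n) (v : Vector ℤ n) : Set where
  constructor _,_
  field
    coefficients : Vector ℤ n
    expansion    : ∀ i → v i ≡ ∑[ k < n ] (A i k ℤ.* coefficients k)

open Span

module _ {n} {A : Matrix n} where

  span-resp : ∀ {u v : Vector ℤ n} → (∀ i → u i ≡ v i) → Span A u → Span A v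
  span-resp u≡v (c , eq) = c , λ i → trans (sym (u≡v i)) (eq i)

  span-+ : ∀ {u v : Vector ℤ n} → Span A u → Span A v → Span A (λ i → u i ℤ.+ v i)
  span-+ (c , eq) (d , eq′) = (λ k → c k ℤ.+ d k) , λ i → trans (cong₂ ℤ._+_ (eq i) (eq′ i))
    (trans (sym (∑-distrib-+ (λ k → A i k ℤ.* c k) (λ k → A i k ℤ.* d k)))
           (sum-cong-≗ λ k → sym (ℤ.*-distribˡ-+ (A i k) (c k) (d k))))

  span-scale : ∀ {u : Vector ℤ n} s → Span A u → Span A (λ i → s ℤ.* u i)
  span-scale s (c , eq) = (λ k → s ℤ.* c k) , λ i → trans (cong (s ℤ.*_) (eq i))
    (trans (*-distribˡ-sum s (λ k → A i k ℤ.* c k)) (sum-cong-≗ λ k → ℤ*-swapˡ s (A i k) (c k)))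

  span-- : ∀ {u v : Vector ℤ n} → Span A u → Span A v → Span A (λ i → u i ℤ.- v i)
  span-- {u} {v} u∈ v∈ = span-resp (λ i → cong (λ t → u i ℤ.+ t) (ℤ.-1*i≡-i (v i))) (span-+ u∈ (span-scale -1ℤ v∈))

  span-0 : Span A (λ _ → 0ℤ)
  span-0 = (λ _ → 0ℤ) , λ i → sym (trans (sum-cong-≗ λ k → ℤ.*-zeroʳ (A i k)) (sum-replicate-zero n))

δ : ∀ {n} → Fin n → Vector ℤ n
δ zero    = 1ℤ ∷ᵥ λ _ → 0ℤ
δ (suc j) = 0ℤ ∷ᵥ δ j

∑-δ : ∀ {n} (v : Vector ℤ n) j → ∑[ k < n ] (v k ℤ.* δ j k) ≡ v j
∑-δ {suc n} v zero = trans
  (cong₂ ℤ._+_ (ℤ.*-identityʳ (v zero))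
    (trans (sum-cong-≗ λ k → ℤ.*-zeroʳ (v (suc k))) (sum-replicate-zero n)))
  (ℤ.+-identityʳ (v zero))
∑-δ v (suc j) = trans
  (cong₂ ℤ._+_ (ℤ.*-zeroʳ (v zero)) (∑-δ (v ∘ suc) j))
  (ℤ.+-identityˡ (v (suc j)))

span-column : ∀ {n} (A : Matrix n) j → Span A (λ i → A i j)
span-column A j = δ j , λ i → sym (∑-δ (A i) j)

-- The coefficients of column j of `B` form column j of the cofactor. All three divisibilities are
-- obtained in this form, B = AC.
columns⇒∣ᴹ : ∀ {n} (A B : Matrix n) → (∀ j → Span A (λ i → B i j)) → A ∣ᴹ B
columns⇒∣ᴹ A B col = (λ k j → coefficients (col j) k) , inj₁ (λ i j → expansion (col j) i)

span-Δ : ∀ {n} {A : Matrix n} w (F : Fin n → ℕ → ℤ) g ps →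
         (∀ y r → Cube g ps y r → Span A (λ i → F i y)) → Span A (λ i → Δ w (F i) g ps)
span-Δ w F g []       F∈ = F∈ g 1 []
span-Δ w F g (p ∷ ps) F∈ = span-- (span-Δ w F (g * p) ps λ y r → F∈ y r ∘ take)
  (span-scale (w p) (span-Δ w F g ps λ y r → F∈ y (p * r) ∘ skip))

-- The top vertex of a cube.

cube-skip-< : ∀ {g p ps y r} → 0 < g * (p * product ps) → 1 < p → Cube g ps y r →
              y < g * (p * product ps)
cube-skip-< {g} {p} {ps} 0<gpP 1<p cube = ≤-<-trans (∣⇒≤ {{gP≢0}} (cube-∣ cube)) gP<gpP
  where
  gPp≡gpP : g * product ps * p ≡ g * (p * product ps)
  gPp≡gpP = trans (*-assoc g (product ps) p) (cong (g *_) (*-comm (product ps) p))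
  gP≢0 : NonZero (g * product ps)
  gP≢0 = m*n≢0⇒m≢0 (g * product ps) {p} {{>-nonZero (subst (0 <_) (sym gPp≡gpP) 0<gpP)}}
  gP<gpP : g * product ps < g * (p * product ps)
  gP<gpP = subst (g * product ps <_) gPp≡gpP (m<m*n (g * product ps) p {{gP≢0}} 1<p)

-- The top vertex misses no factor, so its coefficient is the empty product 1; every other vertex is
-- smaller because all factors exceed 1.
Δ-top : ∀ w F g ps → 0 < g * product ps → All (1 <_) ps →
        (∀ y r → Cube g ps y r → y < g * product ps → F y ≡ 0ℤ) →
        Δ w F g ps ≡ F (g * product ps)
Δ-top w F g []       0<g   []           F≡0 = cong F (sym (*-identityʳ g))
Δ-top w F g (p ∷ ps) 0<gpP (1<p ∷ 1<ps) F≡0 = begin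
  Δ w F (g * p) ps ℤ.- w p ℤ.* Δ w F g ps
    ≡⟨ cong (λ s → Δ w F (g * p) ps ℤ.- w p ℤ.* s)
         (Δ-zero w F g ps λ y r cube → F≡0 y (p * r) (skip cube) (cube-skip-< {g} {p} 0<gpP 1<p cube)) ⟩
  Δ w F (g * p) ps ℤ.- w p ℤ.* 0ℤ
    ≡⟨ cong (λ s → Δ w F (g * p) ps ℤ.- s) (ℤ.*-zeroʳ (w p)) ⟩
  Δ w F (g * p) ps ℤ.+ 0ℤ
    ≡⟨ ℤ.+-identityʳ _ ⟩
  Δ w F (g * p) ps
    ≡⟨ Δ-top w F (g * p) ps (subst (0 <_) (sym gpP) 0<gpP) 1<ps
         (λ y r cube y< → F≡0 y r (take cube) (subst (y <_) gpP y<)) ⟩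
  F (g * p * product ps)
    ≡⟨ cong F gpP ⟩
  F (g * (p * product ps)) ∎
  where
  open ≡-Reasoning
  gpP = *-assoc g p (product ps)

-- Solves the alternating sum for its top vertex, which is possible over ℤ because the coefficient
-- there is 1.
span-top : ∀ {n} {A : Matrix n} w (F : Fin n → ℕ → ℤ) g ps → 0 < g * product ps → All (1 <_) ps →
           Span A (λ i → Δ w (F i) g ps) →
           (∀ y r → Cube g ps y r → y < g * product ps → Span A (λ i → F i y)) →
           Span A (λ i → F i (g * product ps))
span-top {A = A} w F g [] 0<g [] Δ∈ F∈ = subst (λ y → Span A (λ i → F i y)) (sym (*-identityʳ g)) Δ∈
span-top {A = A} w F g (p ∷ ps) 0<gpP (1<p ∷ 1<ps) Δ∈ F∈ =
  subst (λ y → Span A (λ i → F i y)) gpP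
    (span-top w F (g * p) ps (subst (0 <_) (sym gpP) 0<gpP) 1<ps
      (span-resp (λ i → cancel (Δ w (F i) (g * p) ps) (w p ℤ.* Δ w (F i) g ps))
        (span-+ Δ∈ (span-scale (w p) (span-Δ w F g ps λ y r cube →
          F∈ y (p * r) (skip cube) (cube-skip-< {g} {p} 0<gpP 1<p cube)))))
      λ y r cube y< → F∈ y r (take cube) (subst (y <_) gpP y<))
  where
  gpP = *-assoc g p (product ps)
  cancel : ∀ s t → s ℤ.- t ℤ.+ t ≡ s
  cancel = solve-∀

bounded : ∀ {n} (x : Vector ℕ n) → ∃[ N ] (∀ i → x i < N)
bounded {zero}  x = 0 , λ ()
bounded {suc n} x with bounded (x ∘ suc)
... | N , x<N = suc (x zero) ⊔ N , λ
  { zero    → m≤m⊔n (suc (x zero)) N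
  ; (suc i) → ≤-trans (x<N i) (m≤n⊔m (suc (x zero)) N) }

-- Cubes attached to greatest-type divisors.

-- Indexed by an arbitrary list `es`, so that the cube can grow by one greatest-type divisor at a
-- time.
record Decomposition (S : Pred ℕ 0ℓ) (d : ℕ) (es : List ℕ) : Set where
  field
    base     : ℕ
    ratios   : List ℕ
    factored : d ≡ base * product ratios
    coprime  : AllPairs Coprime ratios
    1<ratios : All (1 <_) ratios
    cube⊆    : ∀ y r → Cube base ratios y r → y ∈ S
    matches  : Pointwise (λ e q → e * q ≡ d) es ratios

open Decomposition

∣∧≢⇒< : ∀ {m n} → 0 < n → m ∣ n → m ≢ n → m < n
∣∧≢⇒< 0<n m∣n = ≤∧≢⇒< (∣⇒≤ {{>-nonZero 0<n}} m∣n)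

-- If k divides both ratios, then d / k is still a common multiple of `e` and `e′`. Their lcm d then
-- divides d / k, so k = 1.
coprime-ratios : ∀ {d} e e′ {q q′} → 0 < d → lcm e e′ ≡ d → e * q ≡ d → e′ * q′ ≡ d → Coprime q q′
coprime-ratios e e′ 0<d refl eq≡l e′q′≡l {k} (divides s refl , divides s′ refl) =
  ∣1⇒≡1 (*-cancelˡ-∣ (e * s) {{m*n≢0⇒m≢0 (e * s) {k} {{esk≢0}}}}
    (subst₂ _∣_ (sym esk≡l) (sym (*-identityʳ (e * s))) l∣es))
  where
  esk≡l : e * s * k ≡ lcm e e′
  esk≡l = trans (*-assoc e s k) eq≡l
  esk≢0 : NonZero (e * s * k)
  esk≢0 = >-nonZero (subst (0 <_) (sym esk≡l) 0<d)
  es≡e′s′ : e * s ≡ e′ * s′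
  es≡e′s′ = *-cancelʳ-≡ (e * s) (e′ * s′) k {{m*n≢0⇒n≢0 (e * s) {{esk≢0}}}}
    (trans esk≡l (trans (sym e′q′≡l) (sym (*-assoc e′ s′ k))))
  l∣es : lcm e e′ ∣ e * s
  l∣es = lcm-least {e} {e′} (m∣m*n s) (subst (e′ ∣_) (sym es≡e′s′) (m∣m*n s′))

-- Gcd closed sets under condition G.

module _ {n} (x : Vector ℕ n) (0<x : ∀ i → 0 < x i) (x-injective : Injective _≡_ _≡_ x)
         (gcd-closed : GCDClosed ⟦ x ⟧) (condition-G : ConditionG ⟦ x ⟧) where

  S : Pred ℕ 0ℓ
  S = ⟦ x ⟧

  0<S : ∀ {d} → d ∈ S → 0 < d
  0<S (i , refl) = 0<x i

  G? : ∀ d i → Dec (x i ∈ G S d)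
  G? d i = map′ (λ (y∣d , y<d , max) → (i , refl) , y∣d , y<d , λ { _ (j , refl) → max j })
                (λ (_ , y∣d , y<d , max) → y∣d , y<d , λ j → max (x j) (j , refl))
    (x i ∣? d ×-dec x i <? d ×-dec
     all? λ j → x i ∣? x j →-dec (x j ∣? d →-dec (x j ≟ x i ⊎-dec x j ≟ d)))

  -- Climb from `z` through elements of S strictly between it and `d`; `d ∸ z` decreases, and a `z`
  -- with nothing in between is itself of greatest type.
  below-greatest-type : ∀ {z d} → z ∈ S → d ∈ S → z ∣ d → z ≢ d → ∃[ e ] (e ∈ G S d × z ∣ e)
  below-greatest-type {z} {d} z∈S d∈S = go z∈S (<-wellFounded (d ∸ z))
    where
    go : ∀ {z} → z ∈ S → Acc _<_ (d ∸ z) → z ∣ d → z ≢ d → ∃[ e ] (e ∈ G S d × z ∣ e)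
    go {z} z∈S (acc rec) z∣d z≢d
      with any? (λ k → z ∣? x k ×-dec x k ∣? d ×-dec ¬? (x k ≟ z) ×-dec ¬? (x k ≟ d))
    ... | yes (k , z∣xk , xk∣d , xk≢z , xk≢d) =
      map₂ (map₂ (∣-trans z∣xk)) (go (k , refl) (rec (∸-monoʳ-<
        (∣∧≢⇒< (0<x k) z∣xk (xk≢z ∘ sym)) (∣⇒≤ {{>-nonZero (0<S d∈S)}} xk∣d))) xk∣d xk≢d)
    ... | no ∄k = z , (z∈S , z∣d , ∣∧≢⇒< (0<S d∈S) z∣d z≢d , maximal) , ∣-refl
      where
      maximal : ∀ d′ → d′ ∈ S → z ∣ d′ → d′ ∣ d → d′ ≡ z ⊎ d′ ≡ d
      maximal _ (k , refl) z∣xk xk∣d with x k ≟ z | x k ≟ d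
      ... | yes xk≡z | _        = inj₁ xk≡z
      ... | no _     | yes xk≡d = inj₂ xk≡d
      ... | no xk≢z  | no xk≢d  = ⊥-elim (∄k (k , z∣xk , xk∣d , xk≢z , xk≢d))

  -- Replacing (d , e) by (e′ , gcd e e′) for some e′ ∈ G S d above z preserves
  -- the ratio, and descends to d ≡ z.
  transfer-ratio : ∀ {z d e q} → z ∈ S → d ∈ S → e ∈ G S d → e * q ≡ d → z ∣ d → ¬ z ∣ e →
                   ∃[ f ] (f ∈ G S z × f * q ≡ z)
  transfer-ratio {z} {q = q} z∈S d∈S = go d∈S (<-wellFounded _)
    where
    go : ∀ {d e} → d ∈ S → Acc _<_ d → e ∈ G S d → e * q ≡ d → z ∣ d → ¬ z ∣ e →
         ∃[ f ] (f ∈ G S z × f * q ≡ z)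
    go {d} {e} d∈S (acc rec) e∈G eq≡d z∣d z∤e with z ≟ d
    ... | yes refl = e , e∈G , eq≡d
    ... | no z≢d with below-greatest-type z∈S d∈S z∣d z≢d
    ... | e′ , e′∈G@(e′∈S , _ , e′<d , _) , z∣e′
      with condition-G d d∈S e e′ e∈G e′∈G (λ { refl → z∤e z∣e′ })
    ... | lcm≡d , _ , gcd∈G = go e′∈S (rec e′<d) gcd∈G gq≡e′ z∣e′
                                (λ z∣g → z∤e (∣-trans z∣g (gcd[m,n]∣m e e′)))
      where
      g = gcd e e′
      0<e : 0 < e
      0<e = 0<S (proj₁ e∈G)
      gq≡e′ : g * q ≡ e′
      gq≡e′ = *-cancelˡ-≡ (g * q) e′ e {{>-nonZero 0<e}} (begin
        e * (g * q)  ≡⟨ *-swapˡ e g q ⟩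
        g * (e * q)  ≡⟨ cong (g *_) (trans eq≡d (sym lcm≡d)) ⟩
        g * lcm e e′ ≡⟨ gcd*lcm e e′ ⟩
        e * e′       ∎)
        where open ≡-Reasoning

  -- The ratio q of a new divisor `e` is coprime to the earlier ratios, by condition G, and divides
  -- d = g ∏ ps. Hence q divides the base g and can be moved from it to the ratios.
  decompose : ∀ {d} → d ∈ S → ∀ es → AllPairs _≢_ es → All (_∈ G S d) es → Decomposition S d es
  decompose {d} d∈S [] [] [] = record
    { base = d ; ratios = [] ; factored = sym (*-identityʳ d) ; coprime = [] ; 1<ratios = []
    ; cube⊆ = λ { _ _ [] → d∈S } ; matches = [] }
  decompose {d} d∈S (e ∷ es) (e∉es ∷ es≢) (e∈G@(e∈S , divides q d≡qe , e<d , _) ∷ es∈G)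
    with decompose d∈S es es≢ es∈G
  ... | record { base = g ; ratios = ps ; factored = d≡gP ; coprime = ps⊥ ; 1<ratios = 1<ps
               ; cube⊆ = cube⊆ ; matches = ms } = extend q∣g
    where
    eq≡d : e * q ≡ d
    eq≡d = trans (*-comm e q) (sym d≡qe)
    q⊥ : ∀ {es qs} → All (e ≢_) es → All (_∈ G S d) es → Pointwise (λ e q → e * q ≡ d) es qs → All (Coprime q) qs
    q⊥ []           []            []            = []
    q⊥ (e≢e′ ∷ e∉) (e′∈G ∷ es∈G) (e′q′≡d ∷ ms) =
      coprime-ratios e _ (0<S d∈S) (proj₁ (condition-G d d∈S e _ e∈G e′∈G e≢e′)) eq≡d e′q′≡d ∷ q⊥ e∉ es∈G ms
    q⊥ps : All (Coprime q) ps
    q⊥ps = q⊥ e∉es es∈G ms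
    q∣g : q ∣ g
    q∣g = Coprimality.coprime-divisor (coprime-product q⊥ps)
      (divides e (trans (*-comm (product ps) g) (trans (sym d≡gP) (sym eq≡d))))
    1<q : 1 < q
    1<q = ≰⇒> λ q≤1 → <⇒≱ e<d (subst₂ _≤_ eq≡d (*-identityʳ e) (*-monoʳ-≤ e q≤1))
    extend : q ∣ g → Decomposition S d (e ∷ es)
    extend (divides g′ g≡g′q) = record
      { base = g′ ; ratios = q ∷ ps
      ; factored = trans d≡gP (trans (cong (_* product ps) g≡g′q) (*-assoc g′ q _))
      ; coprime = q⊥ps ∷ ps⊥ ; 1<ratios = 1<q ∷ 1<ps
      ; cube⊆ = cube⊆′ ; matches = eq≡d ∷ ms }
      where
      e≡g′P : e ≡ g′ * product ps
      e≡g′P = *-cancelʳ-≡ e (g′ * product ps) q {{>-nonZero (<-trans z<s 1<q)}}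
        (trans eq≡d (trans d≡gP (trans (cong (_* product ps) g≡g′q) (*-swapʳ g′ q _))))
      cube⊆′ : ∀ y r → Cube g′ (q ∷ ps) y r → y ∈ S
      cube⊆′ y r (take cube) = cube⊆ y r (subst (λ g → Cube g ps y r) (sym g≡g′q) cube)
      -- A new vertex `y`, without `q`, is the gcd of the old vertex `y * q` and of e = y r, because
      -- `q` and `r` are coprime.
      cube⊆′ y _ (skip {r = r} cube) = subst (_∈ S)
        (∣-antisym (coprime-∣ y (cube-coprime q⊥ps cube) (gcd[m,n]∣m (y * q) (y * r)) (gcd[m,n]∣n (y * q) (y * r)))
                   (gcd-greatest (m∣m*n q) (m∣m*n r)))
        (gcd-closed (y * q) (y * r)
          (cube⊆ (y * q) r (subst (λ g → Cube g ps (y * q) r) (sym g≡g′q) (cube-scale q cube)))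
          (subst (_∈ S) (trans e≡g′P (sym (cube-factor cube))) e∈S))

  ∈G? : ∀ d y → Dec (y ∈ G S d)
  ∈G? d y with any? (λ i → x i ≟ y)
  ... | yes (i , refl) = G? d i
  ... | no y∉S         = no λ y∈G → y∉S (proj₁ y∈G)

  greatestTypeDivisors : ℕ → List ℕ
  greatestTypeDivisors d = filter (∈G? d) (tabulate x)

  ∈greatestTypeDivisors : ∀ d → All (_∈ G S d) (greatestTypeDivisors d)
  ∈greatestTypeDivisors d = all-filter (∈G? d) (tabulate x)

  abstract
    -- Abstract, since the later arguments rest only on the properties recorded in `Decomposition`.
    decomposition : ∀ {d} → d ∈ S → Decomposition S d (greatestTypeDivisors d)
    decomposition {d} d∈S = decompose d∈S (greatestTypeDivisors d)
      (Unique.filter⁺ (∈G? d) (Unique.tabulate⁺ x-injective)) (∈greatestTypeDivisors d)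

  ratio⇒∈G : ∀ {d q e} (d∈S : d ∈ S) → q ∈ₗ ratios (decomposition d∈S) → e * q ≡ d → e ∈ G S d
  ratio⇒∈G {d} {q} {e} d∈S q∈ratios eq≡d = go (matches (decomposition d∈S)) (∈greatestTypeDivisors d) q∈ratios
    where
    go : ∀ {es qs} → Pointwise (λ e q → e * q ≡ d) es qs → All (_∈ G S d) es → q ∈ₗ qs → e ∈ G S d
    go (e′q≡d ∷ _) (e′∈G ∷ _) (here refl) = subst (_∈ G S d)
      (*-cancelʳ-≡ _ e q {{m*n≢0⇒n≢0 e {{>-nonZero (subst (0 <_) (sym eq≡d) (0<S d∈S))}}}}
        (trans e′q≡d (sym eq≡d))) e′∈G
    go (_ ∷ ms) (_ ∷ es∈G) (there q∈qs) = go ms es∈G q∈qs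

  ∈G⇒ratio : ∀ {d e} (d∈S : d ∈ S) → e ∈ G S d → ∃[ q ] (q ∈ₗ ratios (decomposition d∈S) × e * q ≡ d)
  ∈G⇒ratio {d} {e} d∈S e∈G@((i , refl) , _) =
    go (matches (decomposition d∈S)) (∈-filter⁺ (∈G? d) (∈-tabulate⁺ i) e∈G)
    where
    go : ∀ {es qs} → Pointwise (λ e q → e * q ≡ d) es qs → e ∈ₗ es → ∃[ q ] (q ∈ₗ qs × e * q ≡ d)
    go (eq≡d ∷ _) (here refl)  = _ , here refl , eq≡d
    go (_ ∷ ms)   (there e∈es) with go ms e∈es
    ... | q , q∈qs , eq≡d = q , there q∈qs , eq≡d

  -- Inclusion-exclusion on gcd and lcm columns.

  Δ-at : (ℕ → ℤ) → (ℕ → ℤ) → ∀ {d} → d ∈ S → ℤ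
  Δ-at w F d∈S = Δ w F (base (decomposition d∈S)) (ratios (decomposition d∈S))

  -- Strong induction on `d`: the other vertices of its cube are smaller elements of S, so the
  -- passage from columns to their `Δ` is unitriangular.
  span-by-Δ : ∀ {A : Matrix n} w (F : Fin n → ℕ → ℤ) →
              (∀ {d} (d∈S : d ∈ S) → Span A (λ i → Δ-at w (F i) d∈S)) →
              ∀ {d} → d ∈ S → Span A (λ i → F i d)
  span-by-Δ {A} w F Δ∈ = go (<-wellFounded _)
    where
    go : ∀ {d} → Acc _<_ d → d ∈ S → Span A (λ i → F i d)
    go {d} (acc rec) d∈S = subst (λ y → Span A (λ i → F i y)) (sym (factored D))
      (span-top w F (base D) (ratios D) (subst (0 <_) (factored D) (0<S d∈S)) (1<ratios D) (Δ∈ d∈S)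
        λ y r cube y<d → go (rec (subst (y <_) (sym (factored D)) y<d)) (cube⊆ D y r cube))
      where D = decomposition d∈S

  -- A greatest-type divisor e = d / q lies above `k`. On an edge from `y` to `y * q` one has e = y
  -- r, so a divisor of `k` that divides `y * q` divides both y q and y r, hence `y`.
  missing-ratio : ∀ {k d} → k ∈ S → (d∈S : d ∈ S) → k ∣ d → k ≢ d →
    let D = decomposition d∈S in
    ∃[ q ] (q ∈ₗ ratios D × (∀ y r m → y * q * r ≡ base D * product (ratios D) → Coprime q r →
                             m ∣ k → m ∣ y * q → m ∣ y))
  missing-ratio {k} {d} k∈S d∈S k∣d k≢d with below-greatest-type k∈S d∈S k∣d k≢d
  ... | e , e∈G , k∣e with ∈G⇒ratio d∈S e∈G
  ... | q , q∈ratios , eq≡d = q , q∈ratios , λ y r m yqr≡d q⊥r m∣k m∣yq →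
    coprime-∣ y q⊥r m∣yq (subst (m ∣_)
      (*-cancelʳ-≡ e (y * r) q {{m*n≢0⇒n≢0 e {{>-nonZero (subst (0 <_) (sym eq≡d) (0<S d∈S))}}}}
        (trans eq≡d (trans (factored (decomposition d∈S)) (trans (sym yqr≡d) (*-swapʳ y q r)))))
      (∣-trans m∣k k∣e))

  cube-∣′ : ∀ {d y r} (d∈S : d ∈ S) → Cube (base (decomposition d∈S)) (ratios (decomposition d∈S)) y r → y ∣ d
  cube-∣′ {y = y} d∈S cube = subst (y ∣_) (sym (factored (decomposition d∈S))) (cube-∣ cube)

  -- As S is gcd closed, gcd(z, d) is a proper divisor of `d` in S, and every `gcd z (y * q)`
  -- divides it; `missing-ratio` then removes `q`.
  gcd-stable : ∀ {z d} → z ∈ S → (d∈S : d ∈ S) → ¬ d ∣ z →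
    let D = decomposition d∈S in
    ∃[ q ] (q ∈ₗ ratios D × (∀ y r → y * q * r ≡ base D * product (ratios D) → Coprime q r →
                             gcd z (y * q) ≡ gcd z y))
  gcd-stable {z} {d} z∈S d∈S d∤z
    with missing-ratio (gcd-closed z d z∈S d∈S) d∈S (gcd[m,n]∣n z d)
           (λ gcd≡d → d∤z (subst (_∣ z) gcd≡d (gcd[m,n]∣m z d)))
  ... | q , q∈ratios , descend = q , q∈ratios , λ y r yqr≡d q⊥r → ∣-antisym
    (gcd-greatest (gcd[m,n]∣m z (y * q))
      (descend y r (gcd z (y * q)) yqr≡d q⊥r
        (gcd-greatest (gcd[m,n]∣m z (y * q))
          (∣-trans (gcd[m,n]∣n z (y * q))
            (subst (y * q ∣_) (trans yqr≡d (sym (factored (decomposition d∈S)))) (m∣m*n r))))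
        (gcd[m,n]∣n z (y * q))))
    (gcd-greatest (gcd[m,n]∣m z y) (∣m⇒∣m*n q (gcd[m,n]∣n z y)))

  -- If `d` divides `z`, the gcd with a vertex is that vertex, and `Δ-pow` applies. Otherwise the
  -- entries agree along the edges in some direction and cancel.
  Δ-gcd : ∀ a {z d} → z ∈ S → (d∈S : d ∈ S) → let D = decomposition d∈S in
          Δ-at unit (λ y → pow a (gcd z y)) d∈S ≡
          pow a (base D) ℤ.* ∏ (pow-1 a) (ratios D) ℤ.* [ d ∣ z ]
  Δ-gcd a {z} {d} z∈S d∈S with d ∣? z
  ... | yes d∣z = trans
    (Δ-cong unit (base D) (ratios D) λ y r cube → cong (pow a)
      (∣-antisym (gcd[m,n]∣n z y) (gcd-greatest (∣-trans (cube-∣′ d∈S cube) d∣z) ∣-refl)))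
    (trans (Δ-pow a (base D) (ratios D)) (sym (ℤ.*-identityʳ (pow a (base D) ℤ.* ∏ (pow-1 a) (ratios D)))))
    where D = decomposition d∈S
  ... | no d∤z with gcd-stable z∈S d∈S d∤z
  ... | q , q∈ratios , stable = trans
    (Δ-vanish unit _ q (base D) (ratios D) q∈ratios (coprime D) λ y r yqr≡d q⊥r →
      trans (cong (pow a) (stable y r yqr≡d q⊥r)) (sym (ℤ.*-identityˡ _)))
    (sym (ℤ.*-zeroʳ (pow a (base D) ℤ.* ∏ (pow-1 a) (ratios D))))
    where D = decomposition d∈S

  -- If `d` divides `z`, the lcm is constantly `z`. Otherwise a stable gcd means that the lcm gains
  -- a factor `q` along each edge, which the weight q^a cancels.
  Δ-lcm : ∀ a {z d} → z ∈ S → (d∈S : d ∈ S) →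
          Δ-at (pow a) (λ y → pow a (lcm z y)) d∈S ≡
          ∏ (pow-1⁻ a) (ratios (decomposition d∈S)) ℤ.* multiplesPow a d z
  Δ-lcm a {z} {d} z∈S d∈S with d ∣? z
  ... | yes d∣z = trans
    (Δ-cong (pow a) (base D) (ratios D) λ y r cube → cong (pow a)
      (∣-antisym (lcm-least {z} ∣-refl (∣-trans (cube-∣′ d∈S cube) d∣z)) (m∣lcm[m,n] z y)))
    (trans (Δ-const (pow a) (pow a z) (base D) (ratios D))
      (trans (ℤ.*-comm (pow a z) _) (cong (∏ (pow-1⁻ a) (ratios D) ℤ.*_) (sym (ℤ.*-identityʳ (pow a z))))))
    where D = decomposition d∈S
  ... | no d∤z with gcd-stable z∈S d∈S d∤z
  ... | q , q∈ratios , stable = trans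
    (Δ-vanish (pow a) _ q (base D) (ratios D) q∈ratios (coprime D) λ y r yqr≡d q⊥r →
      trans (cong (pow a) (lcm-scale y (stable y r yqr≡d q⊥r))) (pow-* a q (lcm z y)))
    (sym (trans (cong (∏ (pow-1⁻ a) (ratios D) ℤ.*_) (ℤ.*-zeroʳ (pow a z)))
               (ℤ.*-zeroʳ (∏ (pow-1⁻ a) (ratios D)))))
    where
    D = decomposition d∈S
    lcm-scale : ∀ y → gcd z (y * q) ≡ gcd z y → lcm z (y * q) ≡ q * lcm z y
    lcm-scale y eq = *-cancelˡ-≡ (lcm z (y * q)) (q * lcm z y) (gcd z y) {{gcd≢0}} (begin
      gcd z y * lcm z (y * q)       ≡⟨ cong (_* lcm z (y * q)) eq ⟨
      gcd z (y * q) * lcm z (y * q) ≡⟨ gcd*lcm z (y * q) ⟩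
      z * (y * q)                   ≡⟨ cong (z *_) (*-comm y q) ⟩
      z * (q * y)                   ≡⟨ *-swapˡ z q y ⟩
      q * (z * y)                   ≡⟨ cong (q *_) (gcd*lcm z y) ⟨
      q * (gcd z y * lcm z y)       ≡⟨ *-swapˡ q (gcd z y) (lcm z y) ⟩
      gcd z y * (q * lcm z y)       ∎)
      where
      open ≡-Reasoning
      gcd≢0 : NonZero (gcd z y)
      gcd≢0 = ≢-nonZero (gcd[m,n]≢0 z y (inj₁ (n>0⇒n≢0 (0<S z∈S))))

  -- Möbius inversion on S.

  -- Orthogonality: splitting off a multiple of the indicator of `k` leaves the coefficients at all
  -- other `d` unchanged.
  Δ-[∣] : ∀ {k d} → k ∈ S → (d∈S : d ∈ S) → k ≢ d → Δ-at unit [ k ∣_] d∈S ≡ 0ℤ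
  Δ-[∣] {k} {d} k∈S d∈S k≢d with k ∣? d
  ... | no k∤d = Δ-zero unit _ _ _ λ y r cube → ∤⇒[∣]≡0 (λ k∣y → k∤d (∣-trans k∣y (cube-∣′ d∈S cube)))
  ... | yes k∣d with missing-ratio k∈S d∈S k∣d k≢d
  ... | q , q∈ratios , descend =
    Δ-vanish unit _ q _ _ q∈ratios (coprime (decomposition d∈S)) λ y r yqr≡d q⊥r → trans
      ([∣]-cong (descend y r k yqr≡d q⊥r ∣-refl) (∣m⇒∣m*n q))
      (sym (ℤ.*-identityˡ _))

  -- F is the sum of Δ_d F · [ d ∣_] over d ∈ S; the terms are split off in
  -- increasing order of d.
  span-by-Möbius : ∀ {A : Matrix n} (w : Vector ℤ n) F →
    (∀ {d} (d∈S : d ∈ S) → Span A (λ i → w i ℤ.* (Δ-at unit F d∈S ℤ.* [ d ∣ x i ]))) →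
    Span A (λ i → w i ℤ.* F (x i))
  span-by-Möbius {A} w F₀ Δ∈₀ = go N 0 (+-identityʳ N) F₀ (λ _ ()) Δ∈₀
    where
    N = proj₁ (bounded x)
    -- `k` sweeps upwards to the bound `N`; at each stage the remaining function vanishes on the
    -- elements of S already passed.
    go : ∀ t k → t + k ≡ N → ∀ F → (∀ {z} → z ∈ S → z < k → F z ≡ 0ℤ) →
         (∀ {d} (d∈S : d ∈ S) → Span A (λ i → w i ℤ.* (Δ-at unit F d∈S ℤ.* [ d ∣ x i ]))) →
         Span A (λ i → w i ℤ.* F (x i))
    go zero k refl F F≡0 Δ∈ = span-resp
      (λ i → sym (trans (cong (w i ℤ.*_) (F≡0 (i , refl) (proj₂ (bounded x) i))) (ℤ.*-zeroʳ (w i))))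
      span-0
    go (suc t) k t+k≡N F F≡0 Δ∈ with any? (λ i → x i ≟ k)
    ... | no k∉S = go t (suc k) (trans (+-suc t k) t+k≡N) F
      (λ { z∈S@(i , refl) z<1+k → F≡0 z∈S (≤∧≢⇒< (s≤s⁻¹ z<1+k) λ z≡k → k∉S (i , z≡k)) }) Δ∈
    ... | yes k∈S = span-resp
      (λ i → recombine (w i) (F (x i)) (F k) [ k ∣ x i ])
      (span-+ (go t (suc k) (trans (+-suc t k) t+k≡N) F′ F′≡0 Δ′∈)
              (span-resp (λ i → cong (λ s → w i ℤ.* (s ℤ.* [ k ∣ x i ])) Δ≡F) (Δ∈ k∈S)))
      where
      F′ : ℕ → ℤ
      F′ z = F z ℤ.- F k ℤ.* [ k ∣ z ]
      recombine : ∀ w f c s → w ℤ.* (f ℤ.- c ℤ.* s) ℤ.+ w ℤ.* (c ℤ.* s) ≡ w ℤ.* f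
      recombine = solve-∀
      K = decomposition k∈S
      -- All vertices of the cube of `k` except the top lie below `k`, where `F` is already 0.
      Δ≡F : Δ-at unit F k∈S ≡ F k
      Δ≡F = trans
        (Δ-top unit F (base K) (ratios K) (subst (0 <_) (factored K) (0<S k∈S)) (1<ratios K)
          λ y r cube y<k → F≡0 (cube⊆ K y r cube) (subst (y <_) (sym (factored K)) y<k))
        (cong F (sym (factored K)))
      F′≡0 : ∀ {z} → z ∈ S → z < suc k → F′ z ≡ 0ℤ
      F′≡0 {z} z∈S z<1+k with z ≟ k
      ... | yes refl = trans
        (cong (λ s → F k ℤ.- F k ℤ.* s) (∣⇒[∣]≡1 (∣-refl {k})))
        (trans (cong (λ s → F k ℤ.- s) (ℤ.*-identityʳ (F k))) (ℤ.+-inverseʳ (F k)))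
      ... | no z≢k = trans
        (cong₂ (λ s t → s ℤ.- F k ℤ.* t) (F≡0 z∈S z<k)
          (∤⇒[∣]≡0 (λ k∣z → <⇒≱ z<k (∣⇒≤ {{>-nonZero (0<S z∈S)}} k∣z))))
        (cong (λ s → 0ℤ ℤ.- s) (ℤ.*-zeroʳ (F k)))
        where
        z<k : z < k
        z<k = ≤∧≢⇒< (s≤s⁻¹ z<1+k) z≢k
      Δ′∈ : ∀ {d} (d∈S : d ∈ S) → Span A (λ i → w i ℤ.* (Δ-at unit F′ d∈S ℤ.* [ d ∣ x i ]))
      Δ′∈ {d} d∈S with k ≟ d
      ... | no k≢d = span-resp
        (λ i → cong (λ s → w i ℤ.* (s ℤ.* [ d ∣ x i ])) (sym (trans
          (Δ-linear unit F [ k ∣_] (F k) (base D) (ratios D))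
          (trans (cong (λ s → Δ-at unit F d∈S ℤ.- F k ℤ.* s) (Δ-[∣] k∈S d∈S k≢d))
            (trans (cong (λ s → Δ-at unit F d∈S ℤ.- s) (ℤ.*-zeroʳ (F k)))
                   (ℤ.+-identityʳ (Δ-at unit F d∈S)))))))
        (Δ∈ d∈S)
        where D = decomposition d∈S
      ... | yes refl = span-resp
        (λ i → sym (trans
          (cong (λ s → w i ℤ.* (s ℤ.* [ d ∣ x i ])) (Δ-zero unit F′ (base D) (ratios D) λ y r cube →
            F′≡0 (cube⊆ D y r cube) (s≤s (∣⇒≤ {{>-nonZero (0<S d∈S)}} (cube-∣′ d∈S cube)))))
          (ℤ.*-zeroʳ (w i))))
        span-0
        where D = decomposition d∈S

  -- This is where condition G meets the coefficient: by `transfer-ratio`, a ratio q of `e` with d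
  -- not dividing e / q is also a ratio of `d`.
  ∏∣∏*Δ-at : ∀ {a c d e} → a ∣ c → (d∈S : d ∈ S) (e∈S : e ∈ S) →
    let D = decomposition d∈S; E = decomposition e∈S in
    pow c (base E) ℤ.* ∏ (pow-1 a) (ratios E) ℤ.∣
    ∏ (pow-1 a) (ratios D) ℤ.* Δ-at unit (multiplesPow c d) e∈S
  ∏∣∏*Δ-at {a} {c} {d} {e} a∣c d∈S e∈S with d ∣? e
  ... | no d∤e = ℤ.divides 0ℤ (trans
    (cong (∏ (pow-1 a) (ratios D) ℤ.*_) (Δ-zero unit _ (base E) (ratios E) λ y r cube →
      trans (cong (pow c y ℤ.*_) (∤⇒[∣]≡0 (λ d∣y → d∤e (∣-trans d∣y (cube-∣′ e∈S cube)))))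
            (ℤ.*-zeroʳ (pow c y))))
    (ℤ.*-zeroʳ (∏ (pow-1 a) (ratios D))))
    where
    D = decomposition d∈S
    E = decomposition e∈S
  ... | yes d∣e = ∏∣∏*Δ-multiplesPow a∣c (base E) (ratios E) (ratios D) (coprime E) (1<ratios E) missing
    where
    D = decomposition d∈S
    E = decomposition e∈S
    missing : ∀ q f → q ∈ₗ ratios E → f * q ≡ base E * product (ratios E) → ¬ d ∣ f → q ∈ₗ ratios D
    missing q f q∈E fq≡gQ d∤f
      with transfer-ratio d∈S e∈S (ratio⇒∈G e∈S q∈E fq≡e) fq≡e d∣e d∤f
      where
      fq≡e : f * q ≡ e
      fq≡e = trans fq≡gQ (sym (factored E))
    ... | h , h∈G , hq≡d with ∈G⇒ratio d∈S h∈G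
    ... | p , p∈D , hp≡d = subst (_∈ₗ ratios D)
      (*-cancelˡ-≡ p q h {{>-nonZero (0<S (proj₁ h∈G))}} (trans hp≡d (sym hq≡d))) p∈D

  -- The row weight `w` lets one expansion serve twice: it is 1 for gcd into lcm, and z^a for lcm
  -- into lcm.
  span-multiplesPow : ∀ {A : Matrix n} (w : Vector ℤ n) a c → a ∣ c →
    (∀ {e} (e∈S : e ∈ S) → let E = decomposition e∈S in
      Span A (λ i → w i ℤ.* (pow c (base E) ℤ.* ∏ (pow-1 a) (ratios E) ℤ.* [ e ∣ x i ]))) →
    ∀ {d} (d∈S : d ∈ S) →
    Span A (λ i → w i ℤ.* (∏ (pow-1 a) (ratios (decomposition d∈S)) ℤ.* multiplesPow c d (x i)))
  span-multiplesPow {A} w a c a∣c ∈A {d} d∈S =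
    span-by-Möbius w (λ z → P ℤ.* multiplesPow c d z) term
    where
    P = ∏ (pow-1 a) (ratios (decomposition d∈S))
    term : ∀ {e} (e∈S : e ∈ S) →
           Span A (λ i → w i ℤ.* (Δ-at unit (λ z → P ℤ.* multiplesPow c d z) e∈S ℤ.* [ e ∣ x i ]))
    term {e} e∈S with ∏∣∏*Δ-at {a} {c} a∣c d∈S e∈S
    ... | ℤ.divides t PΔ≡tα = span-resp
      (λ i → trans (rearrange t (w i) (pow c (base E) ℤ.* ∏ (pow-1 a) (ratios E)) [ e ∣ x i ]) (cong (λ s → w i ℤ.* (s ℤ.* [ e ∣ x i ]))
        (sym (trans (Δ-scale unit (multiplesPow c d) P (base E) (ratios E)) PΔ≡tα))))
      (span-scale t (∈A e∈S))
      where
      E = decomposition e∈S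
      rearrange : ∀ t w α s → t ℤ.* (w ℤ.* (α ℤ.* s)) ≡ w ℤ.* (t ℤ.* α ℤ.* s)
      rearrange = solve-∀

  -- Generators of the column spans and the three divisibilities.

  span-gcdMatrix : ∀ a {d} (d∈S : d ∈ S) → let D = decomposition d∈S in
    Span (gcdMatrix x a) (λ i → pow a (base D) ℤ.* ∏ (pow-1 a) (ratios D) ℤ.* [ d ∣ x i ])
  span-gcdMatrix a d∈S = span-resp (λ i → Δ-gcd a (i , refl) d∈S)
    (span-Δ unit (λ i y → pow a (gcd (x i) y)) (base D) (ratios D) λ y r cube → column (cube⊆ D y r cube))
    where
    D = decomposition d∈S
    column : ∀ {y} → y ∈ S → Span (gcdMatrix x a) (λ i → pow a (gcd (x i) y))
    column (j , refl) = span-column (gcdMatrix x a) j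

  span-lcmMatrix : ∀ a {d} (d∈S : d ∈ S) →
    Span (lcmMatrix x a) (λ i → ∏ (pow-1⁻ a) (ratios (decomposition d∈S)) ℤ.* multiplesPow a d (x i))
  span-lcmMatrix a d∈S = span-resp (λ i → Δ-lcm a (i , refl) d∈S)
    (span-Δ (pow a) (λ i y → pow a (lcm (x i) y)) (base D) (ratios D) λ y r cube → column (cube⊆ D y r cube))
    where
    D = decomposition d∈S
    column : ∀ {y} → y ∈ S → Span (lcmMatrix x a) (λ i → pow a (lcm (x i) y))
    column (j , refl) = span-column (lcmMatrix x a) j

  -- Writing b = a + c makes g^a a visible factor of g^b; together with p^a - 1 dividing p^b - 1
  -- this gives α_a(d) ∣ α_b(d).
  gcdMatrix∣gcdMatrix : ∀ {a c} → a ∣ c → gcdMatrix x a ∣ᴹ gcdMatrix x (a + c)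
  gcdMatrix∣gcdMatrix {a} {c} a∣c = columns⇒∣ᴹ _ _ λ j →
    span-by-Δ unit (λ i y → pow (a + c) (gcd (x i) y)) Δ∈ (j , refl)
    where
    Δ∈ : ∀ {d} (d∈S : d ∈ S) →
         Span (gcdMatrix x a) (λ i → Δ-at unit (λ y → pow (a + c) (gcd (x i) y)) d∈S)
    Δ∈ {d} d∈S with *-mono-∣ pow∣pow (∏-mono-∣ (pow-1∣pow-1 (∣m∣n⇒∣m+n ∣-refl a∣c)) (ratios (decomposition d∈S)))
      where
      pow∣pow : pow a (base (decomposition d∈S)) ℤ.∣ pow (a + c) (base (decomposition d∈S))
      pow∣pow = ℤ.divides (pow c g) (trans (pow-+ a c g) (ℤ.*-comm (pow a g) (pow c g)))
        where g = base (decomposition d∈S)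
    ... | ℤ.divides t eq = span-resp
      (λ i → trans (sym (ℤ.*-assoc t _ [ d ∣ x i ])) (trans (cong (ℤ._* [ d ∣ x i ]) (sym eq))
               (sym (Δ-gcd (a + c) (i , refl) d∈S))))
      (span-scale t (span-gcdMatrix a d∈S))

  -- β_a(d) is a multiple of the product of the p^a - 1, so the expansion of z^a [d ∣ z] in gcd
  -- generators, with c = a, suffices.
  gcdMatrix∣lcmMatrix : ∀ a → gcdMatrix x a ∣ᴹ lcmMatrix x a
  gcdMatrix∣lcmMatrix a = columns⇒∣ᴹ _ _ λ j →
    span-by-Δ (pow a) (λ i y → pow a (lcm (x i) y)) Δ∈ (j , refl)
    where
    Δ∈ : ∀ {d} (d∈S : d ∈ S) →
         Span (gcdMatrix x a) (λ i → Δ-at (pow a) (λ y → pow a (lcm (x i) y)) d∈S)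
    Δ∈ {d} d∈S with ∏-mono-∣ (pow-1∣pow-1⁻ a) (ratios (decomposition d∈S))
    ... | ℤ.divides t eq = span-resp
      (λ i → trans (rearrange t _ (multiplesPow a d (x i))) (trans (cong (ℤ._* multiplesPow a d (x i)) (sym eq))
               (sym (Δ-lcm a (i , refl) d∈S))))
      (span-scale t (span-multiplesPow (λ _ → 1ℤ) a a ∣-refl
        (λ e∈S → span-resp (λ i → sym (ℤ.*-identityˡ _)) (span-gcdMatrix a e∈S)) d∈S))
      where
      rearrange : ∀ t p m → t ℤ.* (1ℤ ℤ.* (p ℤ.* m)) ≡ t ℤ.* p ℤ.* m
      rearrange = solve-∀

  -- Split z^(a+c) as z^a z^c: only z^c [d ∣ z] is expanded, and z^a stays as the row weight that
  -- the lcm generators carry.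
  lcmMatrix∣lcmMatrix : ∀ {a c} → a ∣ c → lcmMatrix x a ∣ᴹ lcmMatrix x (a + c)
  lcmMatrix∣lcmMatrix {a} {c} a∣c = columns⇒∣ᴹ _ _ λ j →
    span-by-Δ (pow (a + c)) (λ i y → pow (a + c) (lcm (x i) y)) Δ∈ (j , refl)
    where
    weighted : ∀ {e} (e∈S : e ∈ S) → let E = decomposition e∈S in
      Span (lcmMatrix x a) (λ i → pow a (x i) ℤ.* (pow c (base E) ℤ.* ∏ (pow-1 a) (ratios E) ℤ.* [ e ∣ x i ]))
    weighted {e} e∈S with ∏-mono-∣ (pow-1⁻∣pow-1 a) (ratios (decomposition e∈S))
    ... | ℤ.divides t eq = span-resp
      (λ i → trans (rearrange (pow c g) t _ (pow a (x i)) [ e ∣ x i ])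
               (cong (λ p → pow a (x i) ℤ.* (pow c g ℤ.* p ℤ.* [ e ∣ x i ])) (sym eq)))
      (span-scale (pow c g ℤ.* t) (span-lcmMatrix a e∈S))
      where
      g = base (decomposition e∈S)
      rearrange : ∀ g t p z s → g ℤ.* t ℤ.* (p ℤ.* (z ℤ.* s)) ≡ z ℤ.* (g ℤ.* (t ℤ.* p) ℤ.* s)
      rearrange = solve-∀
    Δ∈ : ∀ {d} (d∈S : d ∈ S) →
         Span (lcmMatrix x a) (λ i → Δ-at (pow (a + c)) (λ y → pow (a + c) (lcm (x i) y)) d∈S)
    Δ∈ {d} d∈S with ∏-mono-∣ (λ p → ℤ.∣-trans (pow-1∣pow-1 (∣m∣n⇒∣m+n ∣-refl a∣c) p) (pow-1∣pow-1⁻ (a + c) p))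
                             (ratios (decomposition d∈S))
    ... | ℤ.divides t eq = span-resp
      (λ i → trans (rearrange t (pow a (x i)) _ (pow c (x i)) [ d ∣ x i ])
               (trans (cong₂ (λ p z → p ℤ.* (z ℤ.* [ d ∣ x i ])) (sym eq) (sym (pow-+ a c (x i))))
                 (sym (Δ-lcm (a + c) (i , refl) d∈S))))
      (span-scale t (span-multiplesPow (λ i → pow a (x i)) a c a∣c weighted d∈S))
      where
      rearrange : ∀ t z p y s → t ℤ.* (z ℤ.* (p ℤ.* (y ℤ.* s))) ≡ t ℤ.* p ℤ.* (z ℤ.* y ℤ.* s)
      rearrange = solve-∀

theorem4p2 : ∀ (n : ℕ) (x : Vector ℕ n) →
    (∀ i → 0 < x i) →
    Injective _≡_ _≡_ x →
    GCDClosed ⟦ x ⟧ →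
    ConditionG ⟦ x ⟧ →
    ∀ (a b : ℕ) → 0 < a → 0 < b → a ∣ b →
    (gcdMatrix x a ∣ᴹ gcdMatrix x b) ×
    (gcdMatrix x a ∣ᴹ lcmMatrix x a) ×
    (lcmMatrix x a ∣ᴹ lcmMatrix x b)
theorem4p2 n x 0<x x-inj closed cond a _ _ () (divides zero refl)
-- Here b is `suc m * a`, which computes to `a + m * a`, so c = m a.
theorem4p2 n x 0<x x-inj closed cond a _ _ _ (divides (suc m) refl) =
  gcdMatrix∣gcdMatrix x 0<x x-inj closed cond a∣ma ,
  gcdMatrix∣lcmMatrix x 0<x x-inj closed cond a ,
  lcmMatrix∣lcmMatrix x 0<x x-inj closed cond a∣ma
  where
  a∣ma : a ∣ m * a
  a∣ma = divides m refl
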